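{- Let $(\Omega,\rho)$, $h$ and $\mathcal{N}^h_\Omega$ be the Davies–Rogers space, gauge function and $h$-Hausdorff null ideal described in the context, and let $\mathcal{E}$ be the $\sigma$-ideal on $2^\omega$ generated by the closed Lebesgue null sets. Then $$\operatorname{cov}(\mathcal{N}^h_\Omega)\le \operatorname{non}(\mathcal{E})\quad\text{and}\quad \operatorname{cov}(\mathcal{E})\le \operatorname{non}(\mathcal{N}^h_\Omega).$$
   Context: Davies–Rogers space. For every integer $n>0$ there exists (a known result) a finite graph $G$ (identified with its vertex set) such that: (1) $G$ cannot be partitioned into $n$ (possibly empty) independent subsets; (2) for every $w\colon G\to[0,\infty)$ there is an independent $H\subseteq G$ with $\sum_{g\in H}w(g)\ge\frac14\sum_{g\in G}w(g)$; (3) there is a family $\langle H(x):x\in G\rangle$ of independent subsets of $G$ with $x\in H(x)$ for every $x\in G$ and $|\{x\in G: a\in H(x)\}|\ge\frac14|G|$ for every $a\in G$. For each $n$ fix one such graph $G(n)$. Define recursively $M_0=1$, $G_n=G(M_n)$, $N_n=|G_n|$, $M_{n+1}=2N_n$. Let $\Omega=\prod_{n\in\omega}G_n$. For $x\ne y$ in $\Omega$, let $n$ be the least index with $x(n)\neq y(n)$ and put $\rho(x,y)=2^{ -n+1}$ if $x(n),y(n)$ are adjacent in $G_n$ and $\rho(x,y)=2^{ -n}$ otherwise; $\rho(x,x)=0$. This is a metric. The gauge function $h\colon[0,\infty)\to[0,\infty)$ is given by $h(0)=0$, $h(2^{ -n})=\frac{1}{M_0\cdots M_n}$ for $n\in\omega$,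 linear interpolation in between, and (say) $h(t)=1$ for $t>1$. Hausdorff measure. A gauge function is a nondecreasing right-continuous $f\colon[0,\infty)\to[0,\infty)$ with $f(0)=0$. For a metric space $X$ and $A\subseteq X$, $\mathcal{H}^f_{X,\delta}(A)=\inf\{\sum_n f(\operatorname{diam}C_n): A\subseteq\bigcup_{n\in\omega} C_n,\ \operatorname{diam}C_n\le\delta \text{ for all } n\}$, $\mathcal{H}^f_X(A)=\sup_{\delta>0}\mathcal{H}^f_{X,\delta}(A)$ and $\mathcal{N}^f_X=\{A\subseteq X:\mathcal{H}^f_X(A)=0\}$. Thus $\mathcal{N}^h_\Omega$ is an ideal on $\Omega$. Cardinal invariants. For an ideal $\mathcal{I}$ on a set $X$: $\operatorname{cov}(\mathcal{I})$ is the least size of a family $F\subseteq\mathcal{I}$ with $\bigcup F=X$; $\operatorname{non}(\mathcal{I})$ is the least size of a subset of $X$ not in $\mathcal{I}$. -}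

module Defs where

open import Level using (Level; Setω; 0ℓ; _⊔_) renaming (suc to lsuc)
open import Algebra.Bundles using (CommutativeRing; module Semiring)
import Algebra.Definitions.RawSemiring as RawSemiringDefs
open import Axiom.ExcludedMiddle using (ExcludedMiddle)
open import Data.Bool.Base using (Bool; if_then_else_)
open import Data.Fin.Base using (Fin; toℕ)
import Data.Fin.Subset as Sub
open import Data.List.Base using (List; length; lookup)
open import Data.Nat.Base as ℕ using (ℕ; zero; suc)
open import Data.Product using (Σ; ∃; ∃!; _×_; proj₁)
open import Data.Sum.Base using (_⊎_)
open import Data.Vec.Base using (tabulate) renaming (lookup to lookupᵛ)
open import Data.Vec.Functional using (Vector)
open import Function.Base using (flip; _∘_)
open import Function.Bundles using (Func; Surjection; Injection; Inverse)
open import Relation.Binary.Bundles using (Setoid)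
open import Relation.Binary.Core using (Rel)
import Relation.Binary.Construct.Add.Supremum.NonStrict as AddTop
import Relation.Binary.Construct.On as On
open import Relation.Binary.PropositionalEquality using (_≡_; _≢_; refl; sym; trans; _→-setoid_)
open import Relation.Binary.Structures using (IsTotalOrder)
open import Relation.Nullary.Negation.Core using (¬_)
open import Relation.Nullary.Construct.Add.Supremum using (_⁺; [_])
open import Relation.Unary using (Pred; _∈_; _∉_; _⊆_; _≐_; ∁; ⋃; Satisfiable)
open import Relation.Unary.Properties using (≐-refl; ≐-sym; ≐-trans)

private variable
  a b ℓ ℓ₁ ℓ₂ : Level

Classical : Setω
Classical = ∀ ℓ → ExcludedMiddle ℓ

-- Choice is stated for setoids, i.e. for sets with a nontrivial
-- equality: the section has to respect the equalities.  (Without that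
-- requirement it would be provable outright.)

AxiomOfChoice : Setω
AxiomOfChoice =
  ∀ {a b ℓ₁ ℓ₂} (A : Setoid a ℓ₁) (B : Setoid b ℓ₂) (f : Surjection A B) →
  Σ (Func B A) λ g →
    ∀ y → Setoid._≈_ B (Surjection.to f (Func.to g y)) y

UpperBound : {A : Set a} → Rel A ℓ₁ → Pred A ℓ → Pred A (a ⊔ ℓ₁ ⊔ ℓ)
UpperBound _≤_ P u = ∀ x → x ∈ P → x ≤ u

IsLub : {A : Set a} → Rel A ℓ₁ → Pred A ℓ → Pred A (a ⊔ ℓ₁ ⊔ ℓ)
IsLub _≤_ P s = UpperBound _≤_ P s × (∀ u → UpperBound _≤_ P u → s ≤ u)

IsGlb : {A : Set a} → Rel A ℓ₁ → Pred A ℓ → Pred A (a ⊔ ℓ₁ ⊔ ℓ)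
IsGlb _≤_ = IsLub (flip _≤_)

-- The real numbers: a Dedekind-complete ordered field, which is unique
-- up to isomorphism.  As in many libraries the inverse is total, with
-- an unspecified value at 0.
record Reals : Set₁ where
  infix 4 _≤_ _<_
  infix 8 _⁻¹
  field
    commutativeRing : CommutativeRing 0ℓ 0ℓ

  open CommutativeRing commutativeRing public
    using (_≈_; _+_; _*_; _-_; 0#; 1#; semiring)
    renaming (Carrier to ℝ)

  field
    _⁻¹          : ℝ → ℝ
    0≉1          : ¬ (0# ≈ 1#)
    *-inverse    : ∀ x → ¬ (x ≈ 0#) → x * x ⁻¹ ≈ 1#
    _≤_          : Rel ℝ 0ℓ
    isTotalOrder : IsTotalOrder _≈_ _≤_
    +-mono-≤     : ∀ x {y z} → y ≤ z → x + y ≤ x + z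
    *-nonneg     : ∀ {x y} → 0# ≤ x → 0# ≤ y → 0# ≤ x * y
    complete     : (P : Pred ℝ 0ℓ) → Satisfiable P →
                   Satisfiable (UpperBound _≤_ P) → ∃ (IsLub _≤_ P)

  _<_ : Rel ℝ 0ℓ
  x < y = x ≤ y × ¬ (x ≈ y)

  open RawSemiringDefs (Semiring.rawSemiring semiring) public
    using (_^_; sum)
    renaming (_×_ to _·_)

  fromℕ : ℕ → ℝ
  fromℕ n = n · 1#

  ½^_ : ℕ → ℝ
  ½^ n = (fromℕ 2 ⁻¹) ^ n

  -- ℝ ∪ {∞}, in particular inf ∅ = ∞
  ℝ∞ : Set
  ℝ∞ = ℝ ⁺

  open AddTop _≤_ public using () renaming (_≤⁺_ to _≤∞_)

  -- Sum of a series with nonnegative terms, possibly ∞.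

  IsSum : (ℕ → ℝ) → ℝ∞ → Set
  IsSum t = IsLub _≤∞_ λ s → ∃ λ n → s ≡ [ sum {n} (t ∘ toℕ) ]

module Hausdorff (R : Reals) {X : Set} (dist : X → X → Reals.ℝ R)
                 (f : Reals.ℝ R → Reals.ℝ R) where
  open Reals R

  -- Including 0 only matters for C empty, where it gives diam ∅ = 0.

  IsDiam : Pred X 0ℓ → ℝ → Set
  IsDiam C = IsLub _≤_ λ r →
    r ≈ 0# ⊎ ∃ λ x → ∃ λ y → x ∈ C × y ∈ C × r ≈ dist x y

  CoverSum : ℝ → Pred X 0ℓ → Pred ℝ∞ (lsuc 0ℓ)
  CoverSum δ A s =
    Σ (ℕ → Pred X 0ℓ) λ C → Σ (ℕ → ℝ) λ d →
      A ⊆ ⋃ ℕ C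
      × (∀ n → IsDiam (C n) (d n) × d n ≤ δ)
      × IsSum (f ∘ d) s

  IsHausdorffδ : ℝ → Pred X 0ℓ → ℝ∞ → Set₁
  IsHausdorffδ δ A = IsGlb _≤∞_ (CoverSum δ A)

  IsHausdorff : Pred X 0ℓ → ℝ∞ → Set₁
  IsHausdorff A v = Σ (ℝ → ℝ∞) λ H →
    (∀ δ → 0# < δ → IsHausdorffδ δ A (H δ))
    × IsLub _≤∞_ (λ u → ∃ λ δ → 0# < δ × u ≡ H δ) v

  HausdorffNull : Pred (Pred X 0ℓ) (lsuc 0ℓ)
  HausdorffNull A = IsHausdorff A [ 0# ]

record Graph : Set₁ where
  field
    order    : ℕ
    _~_      : Rel (Fin order) 0ℓ
    ~-sym    : ∀ {u v} → u ~ v → v ~ u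
    ~-irrefl : ∀ {v} → ¬ (v ~ v)

  Vertex : Set
  Vertex = Fin order

  Independent : Pred (Sub.Subset order) 0ℓ
  Independent H = ∀ {u v} → u Sub.∈ H → v Sub.∈ H → ¬ (u ~ v)

record IsDaviesRogersGraph (R : Reals) (n : ℕ) (G : Graph) : Set where
  open Reals R
  open Graph G

  -- Σ_{g ∈ H} w(g)
  weight : Vector ℝ order → Sub.Subset order → ℝ
  weight w H = sum λ g → if lookupᵛ H g then w g else 0#

  field
    no-partition :
      ¬ ∃ λ (P : Fin n → Sub.Subset order) →
          (∀ i → Independent (P i)) × (∀ v → ∃! _≡_ λ i → v Sub.∈ P i)
    heavy-independent :
      (w : Vector ℝ order) → (∀ g → 0# ≤ w g) →
      ∃ λ H → Independent H × fromℕ 4 ⁻¹ * sum w ≤ weight w H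
    independent-family :
      ∃ λ (H : Vertex → Sub.Subset order) →
          (∀ x → Independent (H x))
        × (∀ x → x Sub.∈ H x)
        × (∀ a → order ℕ.≤ 4 ℕ.* Sub.∣ tabulate (λ x → lookupᵛ (H x) a) ∣)

module Construction (R : Reals) (graph : ℕ → Graph) where
  open Reals R
  open Graph using (order; Vertex)

  M : ℕ → ℕ
  M zero    = 1
  M (suc n) = 2 ℕ.* order (graph (M n))

  G : ℕ → Graph
  G n = graph (M n)

  Ω : Set
  Ω = ∀ n → Vertex (G n)

  Ω-setoid : Setoid 0ℓ 0ℓ
  Ω-setoid = record
    { Carrier = Ω
    ; _≈_ = λ x y → ∀ n → x n ≡ y n
    ; isEquivalence = record
      { refl  = λ _ → refl
      ; sym   = λ p n → sym (p n)
      ; trans = λ p q n → trans (p n) (q n)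
      }
    }

  LeastDifference : Ω → Ω → ℕ → Set
  LeastDifference x y n = (∀ i → i ℕ.< n → x i ≡ y i) × x n ≢ y n

  -- Classically the three clauses cover all pairs of points, so they
  -- determine ρ.

  record IsMetricρ (ρ : Ω → Ω → ℝ) : Set where
    field
      ρ-equal : ∀ {x y} → (∀ n → x n ≡ y n) → ρ x y ≈ 0#
      ρ-adjacent : ∀ {x y n} → LeastDifference x y n →
        Graph._~_ (G n) (x n) (y n) → ρ x y ≈ fromℕ 2 * ½^ n
      ρ-nonadjacent : ∀ {x y n} → LeastDifference x y n →
        ¬ Graph._~_ (G n) (x n) (y n) → ρ x y ≈ ½^ n

  M-product : ℕ → ℕ
  M-product zero    = M zero
  M-product (suc n) = M-product n ℕ.* M (suc n)

  -- Only arguments t ≥ 0 matter, and on those h is determined.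

  record IsGaugeh (h : ℝ → ℝ) : Set where
    field
      h-zero  : ∀ {t} → t ≈ 0# → h t ≈ 0#
      h-power : ∀ n → h (½^ n) ≈ fromℕ (M-product n) ⁻¹
      h-large : ∀ {t} → 1# < t → h t ≈ 1#
      -- On [p , q] the graph of h is the chord from p to q.
      h-linear : ∀ n {t} → let p = ½^ (suc n); q = ½^ n in
        p ≤ t → t ≤ q → (h t - h p) * (q - p) ≈ (h q - h p) * (t - p)

-- Graphs G(n) fixed for all n > 0, together with the resulting ρ and h;
-- graph 0 is never used, as every Mₙ is positive.

record DaviesRogers (R : Reals) : Set₁ where
  open Reals R
  field
    graph   : ℕ → Graph
    isGraph : ∀ n → 0 ℕ.< n → IsDaviesRogersGraph R n (graph n)

  open Construction R graph public

  field
    ρ   : Ω → Ω → ℝ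
    isρ : IsMetricρ ρ
    h   : ℝ → ℝ
    ish : IsGaugeh h

  𝓝 : Pred (Pred Ω 0ℓ) (lsuc 0ℓ)
  𝓝 = Hausdorff.HausdorffNull R ρ h

open DaviesRogers public using (Ω-setoid; 𝓝)

Cantor : Set
Cantor = ℕ → Bool

Cantor-setoid : Setoid 0ℓ 0ℓ
Cantor-setoid = ℕ →-setoid Bool

IsOpen : Pred (Pred Cantor 0ℓ) 0ℓ
IsOpen O = ∀ x → x ∈ O → ∃ λ n → ∀ y → (∀ i → i ℕ.< n → x i ≡ y i) → y ∈ O

IsClosed : Pred (Pred Cantor 0ℓ) 0ℓ
IsClosed C = IsOpen (∁ C)

Cylinder : List Bool → Pred Cantor 0ℓ
Cylinder s x = ∀ (i : Fin (length s)) → x (toℕ i) ≡ lookup s i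

data σ-Ideal {X : Set} (𝓖 : Pred (Pred X 0ℓ) ℓ) : Pred (Pred X 0ℓ) (lsuc 0ℓ ⊔ ℓ) where
  generator : ∀ {A} → A ∈ 𝓖 → σ-Ideal 𝓖 A
  subset    : ∀ {A B} → A ⊆ B → σ-Ideal 𝓖 B → σ-Ideal 𝓖 A
  union     : (A : ℕ → Pred X 0ℓ) → (∀ n → σ-Ideal 𝓖 (A n)) → σ-Ideal 𝓖 (⋃ ℕ A)

module Lebesgue (R : Reals) where
  open Reals R

  -- The outer measure induced by the fair coin-tossing measure
  IsOuterMeasure : Pred Cantor 0ℓ → ℝ∞ → Set
  IsOuterMeasure A = IsGlb _≤∞_ λ v → ∃ λ (s : ℕ → List Bool) →
    A ⊆ ⋃ ℕ (Cylinder ∘ s) × IsSum (λ n → ½^ length (s n)) v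

  LebesgueNull : Pred (Pred Cantor 0ℓ) 0ℓ
  LebesgueNull A = IsOuterMeasure A [ 0# ]

  𝓔 : Pred (Pred Cantor 0ℓ) (lsuc 0ℓ)
  𝓔 = σ-Ideal λ C → IsClosed C × LebesgueNull C

open Lebesgue public using (𝓔)

-- Cardinal numbers are represented by setoids:
-- equipotence is a bijection, and ≤ is an injection, of setoids.
_≲_ : Setoid a ℓ₁ → Setoid b ℓ₂ → Set (a ⊔ b ⊔ ℓ₁ ⊔ ℓ₂)
_≲_ = Injection

_≅_ : Setoid a ℓ₁ → Setoid b ℓ₂ → Set (a ⊔ b ⊔ ℓ₁ ⊔ ℓ₂)
_≅_ = Inverse

∥_∥ : {S : Setoid a ℓ₁} → Pred (Setoid.Carrier S) ℓ → Setoid (a ⊔ ℓ) ℓ₁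
∥_∥ {S = S} A = On.setoid {B = Σ (Setoid.Carrier S) A} S proj₁

PowerSetoid : Set → Setoid (lsuc 0ℓ) 0ℓ
PowerSetoid X = record
  { Carrier = Pred X 0ℓ
  ; _≈_ = _≐_
  ; isEquivalence = record { refl = ≐-refl ; sym = ≐-sym ; trans = ≐-trans }
  }

module Invariants (S : Setoid 0ℓ 0ℓ) (𝓘 : Pred (Pred (Setoid.Carrier S) 0ℓ) (lsuc 0ℓ)) where
  private X = Setoid.Carrier S

  Family : Set₂
  Family = Pred (Pred X 0ℓ) (lsuc 0ℓ)

  IsCoveringFamily : Pred Family (lsuc 0ℓ)
  IsCoveringFamily F = F ⊆ 𝓘 × (∀ x → ∃ λ A → A ∈ F × x ∈ A)

  IsCov : Setoid a ℓ → Set (a ⊔ ℓ ⊔ lsuc (lsuc 0ℓ))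
  IsCov κ =
    (∃ λ F → IsCoveringFamily F × κ ≅ ∥_∥ {S = PowerSetoid X} F)
    × (∀ F → IsCoveringFamily F → κ ≲ ∥_∥ {S = PowerSetoid X} F)

  IsNon : Setoid a ℓ → Set (a ⊔ ℓ ⊔ lsuc 0ℓ)
  IsNon κ =
    (∃ λ A → A ∉ 𝓘 × κ ≅ ∥_∥ {S = S} A)
    × (∀ A → A ∉ 𝓘 → κ ≲ ∥_∥ {S = S} A)

open Invariants public using (IsCov; IsNon)

{-# OPTIONS --safe #-}
module Submission where

-- Read x ∈ 2^ω blockwise as a point z ∈ Ω, and relate it to y ∈ Ω when
-- y(n) ∈ H(z(n)) for infinitely many n.
--
-- For fixed x the related y form an h-null set: those with
-- y(n) ∈ H(z(n)) are covered by N₀⋯Nₙ₋₁ sets of diameter 2⁻ⁿ, one for each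
-- prefix of length n, because H(z(n)) is independent.  Each has
-- h-value 1/(M₀⋯Mₙ), so they contribute 2⁻ⁿ in total.
--
-- For fixed y the unrelated x lie in 𝓔: clause (3) makes y(n) ∈ H(z(n)) an
-- event of probability ≥ 1/8, independently for different n, so that
-- failure from some n₀ onwards is a closed null condition.
--
-- A relation with these two kinds of small sections gives both inequalities.

open import Defs
open import Level using (0ℓ) renaming (suc to lsuc)
open import Algebra.Bundles using (CommutativeRing)
import Algebra.Properties.Ring as RingProperties
import Algebra.Properties.Semiring.Mult as SemiringMult
open import Data.Bool.Base using (Bool; true)
open import Data.Empty using (⊥-elim)
open import Data.Fin.Base as Fin using (Fin; zero; suc; toℕ; fromℕ<; combine; remQuot; splitAt; join)
open import Data.Fin.Properties using (remQuot-combine; join-splitAt; cast-involutive; 2↔Bool)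
open import Data.Fin.Subset as Sub using (Subset; inside; outside; ∣_∣)
open import Data.Fin.Subset.Properties using (∣∁p∣≡n∸∣p∣; ∣p∣≤n; x∉p⇒x∈∁p; ∉⊥; ∈⊤)
open import Data.List.Base as List
  using (List; []; _∷_; _++_; map; length; allFin; cartesianProductWith; replicate)
open import Data.List.Membership.Propositional using () renaming (_∈_ to _∈ₗ_)
open import Data.List.Membership.Propositional.Properties
  using (∈-map⁺; ∈-++⁺ˡ; ∈-++⁺ʳ; ∈-allFin; ∈-cartesianProductWith⁺)
open import Data.List.Properties using (length-map; length-++; length-tabulate; length-replicate)
open import Data.List.Relation.Unary.Any using (here; there)
open import Data.Maybe.Base using (Maybe; just; nothing)
open import Data.Nat.Base as ℕ using (ℕ; zero; suc; z≤n; s≤s; z<s; s<s)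
import Data.Nat.Properties as ℕₚ
open import Data.Nat.Solver using (module +-*-Solver)
open import Data.Product using (∃; ∃₂; ∃!; _×_; _,_; proj₁; proj₂)
open import Data.Sum.Base using (_⊎_; inj₁; inj₂; [_,_]′)
open import Data.Unit.Base using (tt)
open import Data.Vec.Base as Vec using (Vec; []; _∷_; toList)
open import Data.Vec.Properties using (length-toList; []=⇒lookup; lookup⇒[]=; lookup∘tabulate)
open import Function.Base using (_∘_; id; const; flip)
open import Function.Bundles using (Inverse; Func; Surjection)
open import Function.Construct.Composition using (injection)
open import Function.Properties.Inverse using (Inverse⇒Injection) renaming (sym to inverse-sym)
open import Relation.Binary.Bundles using (Setoid; Poset)
open import Relation.Binary.Construct.Add.Supremum.NonStrict using ([_]; _≤⊤⁺; [≤]-injective; ≤⁺-trans)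
open import Relation.Binary.PropositionalEquality as ≡ using (_≡_; _≢_; refl; cong; subst)
open import Relation.Binary.Structures using (IsTotalOrder)
open import Relation.Nullary using (¬_; yes; no)
open import Relation.Nullary.Construct.Add.Supremum using (⊤⁺; [_])
open import Relation.Nullary.Decidable using (decidable-stable)
open import Relation.Unary using (Pred; _∈_; _∉_; _⊆_; _≐_; ∅; ⋃)

private variable
  A B C : Set

-- Enumerating finite sets.

elements : ∀ {n} → Subset n → List (Fin n)
elements []            = []
elements (inside  ∷ p) = zero ∷ map suc (elements p)
elements (outside ∷ p) = map suc (elements p)

length-elements : ∀ {n} (p : Subset n) → length (elements p) ≡ ∣ p ∣
length-elements []            = refl
length-elements (inside  ∷ p) = cong suc (≡.trans (length-map suc (elements p)) (length-elements p))
length-elements (outside ∷ p) = ≡.trans (length-map suc (elements p)) (length-elements p)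

∈-elements : ∀ {n} {p : Subset n} {x} → x Sub.∈ p → x ∈ₗ elements p
∈-elements {p = inside  ∷ p} Vec.here      = here refl
∈-elements {p = inside  ∷ p} (Vec.there q) = there (∈-map⁺ suc (∈-elements q))
∈-elements {p = outside ∷ p} (Vec.there q) = ∈-map⁺ suc (∈-elements q)

length-cartesianProductWith : (f : A → B → C) (xs : List A) (ys : List B) →
  length (cartesianProductWith f xs ys) ≡ length xs ℕ.* length ys
length-cartesianProductWith f []       ys = refl
length-cartesianProductWith f (x ∷ xs) ys = ≡.trans (length-++ (map (f x) ys))
  (≡.cong₂ ℕ._+_ (length-map (f x) ys) (length-cartesianProductWith f xs ys))

-- Bit strings and block codes.

fromBits : ∀ {k} → Vec Bool k → Fin (2 ℕ.^ k)
fromBits []      = zero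
fromBits (b ∷ v) = combine (Inverse.from 2↔Bool b) (fromBits v)

toBits : ∀ {k} → Fin (2 ℕ.^ k) → Vec Bool k
toBits {zero}  i = []
toBits {suc k} i = Inverse.to 2↔Bool (proj₁ (remQuot {2} (2 ℕ.^ k) i)) ∷ toBits (proj₂ (remQuot {2} (2 ℕ.^ k) i))

toBits∘fromBits : ∀ {k} (v : Vec Bool k) → toBits (fromBits v) ≡ v
toBits∘fromBits []      = refl
toBits∘fromBits (b ∷ v) = ≡.cong₂ _∷_
  (≡.trans (cong (Inverse.to 2↔Bool ∘ proj₁) split) (Inverse.strictlyInverseˡ 2↔Bool b))
  (≡.trans (cong (toBits ∘ proj₂) split) (toBits∘fromBits v))
  where split = remQuot-combine (Inverse.from 2↔Bool b) (fromBits v)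

allBits : ∀ k → List (Vec Bool k)
allBits k = map (toBits {k}) (allFin (2 ℕ.^ k))

length-allBits : ∀ k → length (allBits k) ≡ 2 ℕ.^ k
length-allBits k = ≡.trans (length-map (toBits {k}) (allFin (2 ℕ.^ k))) (length-tabulate {n = 2 ℕ.^ k} id)

∈-allBits : ∀ {k} (v : Vec Bool k) → v ∈ₗ allBits k
∈-allBits v = subst (_∈ₗ allBits _) (toBits∘fromBits v) (∈-map⁺ toBits (∈-allFin (fromBits v)))

-- Raising the number by one uses up one unit of the excess `r`; at excess 0 the number is itself a
-- power of 2, and the next power is its double. The bound on `r` means that at least half of the
-- strings of length `k` code a number directly.
next-power-of-2 : ∀ n → ∃₂ λ k r → r ℕ.≤ suc n × suc n ℕ.+ r ≡ 2 ℕ.^ k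
next-power-of-2 zero    = 0 , 0 , z≤n , refl
next-power-of-2 (suc n) with next-power-of-2 n
... | k , suc r , r≤n , eq = k , r , ℕₚ.≤-trans (ℕₚ.n≤1+n r) (ℕₚ.m≤n⇒m≤1+n r≤n) ,
  ≡.trans (≡.sym (ℕₚ.+-suc (suc n) r)) eq
... | k , zero  , _   , eq = suc k , n , ℕₚ.m≤n⇒m≤1+n (ℕₚ.n≤1+n n) , (begin
  suc (suc n) ℕ.+ n                   ≡⟨ ≡.sym (ℕₚ.+-suc (suc n) n) ⟩
  suc n ℕ.+ suc n                     ≡⟨ ≡.cong₂ ℕ._+_ eq′ (≡.trans eq′ (≡.sym (ℕₚ.+-identityʳ _))) ⟩
  2 ℕ.^ k ℕ.+ (2 ℕ.^ k ℕ.+ 0)         ∎)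
  where
  open ≡.≡-Reasoning
  eq′ : suc n ≡ 2 ℕ.^ k
  eq′ = ≡.trans (≡.sym (ℕₚ.+-identityʳ (suc n))) eq

-- Every set of density ≥ 1/4 pulls back to a set of bit strings of density ≥ 1/8.
record BlockCode (n : ℕ) : Set where
  field
    size     : ℕ
    symbol   : Vec Bool size → Fin n
    miss     : Subset n → List (Vec Bool size)
    ∈-miss   : ∀ {S v} → symbol v Sub.∉ S → v ∈ₗ miss S
    ∣miss∣   : ∀ {S} → n ℕ.≤ 4 ℕ.* ∣ S ∣ → 8 ℕ.* length (miss S) ℕ.≤ 7 ℕ.* 2 ℕ.^ size

-- Each symbol gets one string of its own, and the `r` remaining strings all decode to the default
-- `d`.
blockCode : ∀ {n} → Fin n → BlockCode n
blockCode {suc n₀} d with next-power-of-2 n₀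
... | k , r , r≤n , eq = record
  { size   = k
  ; symbol = λ v → decode (position v)
  ; miss   = λ S → map word (missed S)
  ; ∈-miss = λ {S} {v} ∉S → subst (_∈ₗ map word (missed S)) (word∘position v)
               (∈-map⁺ word (∈-missed (position v) ∉S))
  ; ∣miss∣ = λ {S} → bound {S}
  }
  where
  n = suc n₀
  decode : Fin n ⊎ Fin r → Fin n
  decode = [ id , const d ]′
  position : Vec Bool k → Fin n ⊎ Fin r
  position v = splitAt n (Fin.cast (≡.sym eq) (fromBits v))
  word : Fin n ⊎ Fin r → Vec Bool k
  word p = toBits (Fin.cast eq (join n r p))
  word∘position : ∀ v → word (position v) ≡ v
  word∘position v
    rewrite join-splitAt n r (Fin.cast (≡.sym eq) (fromBits v))
          | cast-involutive eq (≡.sym eq) (fromBits v) = toBits∘fromBits v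
  missed : Subset n → List (Fin n ⊎ Fin r)
  -- All remaining strings are listed, even if `d` lies in `S`, so the count is independent of `d`.
  missed S = map inj₁ (elements (Sub.∁ S)) ++ map inj₂ (allFin r)
  ∈-missed : ∀ {S} p → decode p Sub.∉ S → p ∈ₗ missed S
  ∈-missed (inj₁ i) ∉S = ∈-++⁺ˡ (∈-map⁺ inj₁ (∈-elements (x∉p⇒x∈∁p ∉S)))
  ∈-missed (inj₂ j) _  = ∈-++⁺ʳ _ (∈-map⁺ inj₂ (∈-allFin j))
  length-missed : ∀ S → length (map word (missed S)) ≡ ∣ Sub.∁ S ∣ ℕ.+ r
  length-missed S = ≡.trans (length-map word (missed S)) (≡.trans (length-++ (map inj₁ (elements (Sub.∁ S))))
    (≡.cong₂ ℕ._+_ (≡.trans (length-map inj₁ (elements (Sub.∁ S))) (length-elements (Sub.∁ S)))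
                   (≡.trans (length-map inj₂ (allFin r)) (length-tabulate {n = r} id))))
  bound : ∀ {S} → n ℕ.≤ 4 ℕ.* ∣ S ∣ → 8 ℕ.* length (map word (missed S)) ℕ.≤ 7 ℕ.* 2 ℕ.^ k
  bound {S} n≤4s = begin
    8 ℕ.* length (map word (missed S))   ≡⟨ cong (8 ℕ.*_) (length-missed S) ⟩
    8 ℕ.* (c ℕ.+ r)                      ≡⟨ solve 2 (λ c r → con 8 :* (c :+ r) := con 2 :* (con 4 :* c) :+ (con 7 :* r :+ r)) refl c r ⟩
    2 ℕ.* (4 ℕ.* c) ℕ.+ (7 ℕ.* r ℕ.+ r)  ≤⟨ ℕₚ.+-mono-≤ (ℕₚ.*-monoʳ-≤ 2 4c≤3n) (ℕₚ.+-monoʳ-≤ (7 ℕ.* r) r≤n) ⟩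
    2 ℕ.* (3 ℕ.* n) ℕ.+ (7 ℕ.* r ℕ.+ n)  ≡⟨ solve 2 (λ n r → con 2 :* (con 3 :* n) :+ (con 7 :* r :+ n) := con 7 :* (n :+ r)) refl n r ⟩
    7 ℕ.* (n ℕ.+ r)                      ≡⟨ cong (7 ℕ.*_) eq ⟩
    7 ℕ.* 2 ℕ.^ k                        ∎
    where
    open ℕₚ.≤-Reasoning
    open +-*-Solver
    c = ∣ Sub.∁ S ∣
    c+s≡n : c ℕ.+ ∣ S ∣ ≡ n
    c+s≡n = ≡.trans (cong (ℕ._+ ∣ S ∣) (∣∁p∣≡n∸∣p∣ S)) (ℕₚ.m∸n+n≡m (∣p∣≤n S))
    4c≤3n : 4 ℕ.* c ℕ.≤ 3 ℕ.* n
    4c≤3n = ℕₚ.+-cancelʳ-≤ n (4 ℕ.* c) (3 ℕ.* n) (begin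
      4 ℕ.* c ℕ.+ n            ≤⟨ ℕₚ.+-monoʳ-≤ (4 ℕ.* c) n≤4s ⟩
      4 ℕ.* c ℕ.+ 4 ℕ.* ∣ S ∣  ≡⟨ ≡.sym (ℕₚ.*-distribˡ-+ 4 c ∣ S ∣) ⟩
      4 ℕ.* (c ℕ.+ ∣ S ∣)      ≡⟨ cong (4 ℕ.*_) c+s≡n ⟩
      4 ℕ.* n                  ≡⟨ solve 1 (λ n → con 4 :* n := con 3 :* n :+ n) refl n ⟩
      3 ℕ.* n ℕ.+ n            ∎)

-- Concatenating infinitely many finite lists.

flatten : (ℕ → A) → (ℕ → List A) → List A → ℕ → ℕ → A
flatten hd tl []       n zero    = hd n
-- `hd n` stands before `tl n`, so every stage yields an entry even if `tl n` is empty, and the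
-- recursion descends in the index.
flatten hd tl []       n (suc i) = flatten hd tl (tl n) (suc n) i
flatten hd tl (x ∷ xs) n zero    = x
flatten hd tl (x ∷ xs) n (suc i) = flatten hd tl xs n i

module _ (hd : ℕ → A) (tl : ℕ → List A) where

  flatten-here : ∀ {a xs n} → a ∈ₗ xs → ∃ λ i → flatten hd tl xs n i ≡ a
  flatten-here (here refl) = 0 , refl
  flatten-here (there p)   = let (i , eq) = flatten-here p in suc i , eq

  flatten-skip : ∀ {a} xs {n} → (∃ λ i → flatten hd tl [] n i ≡ a) → ∃ λ i → flatten hd tl xs n i ≡ a
  flatten-skip []       p = p
  flatten-skip (x ∷ xs) p = let (i , eq) = flatten-skip xs p in suc i , eq

  flatten-there : ∀ {a} j {m n xs} → a ∈ₗ tl m → j ℕ.+ n ≡ m → ∃ λ i → flatten hd tl xs n i ≡ a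
  flatten-there zero    {n = n} {xs} p refl =
    let (i , eq) = flatten-here {xs = tl n} p in flatten-skip xs (suc i , eq)
  flatten-there (suc j) {n = n} {xs} p eq =
    let (i , eq) = flatten-there j {xs = tl n} p (≡.trans (ℕₚ.+-suc j n) eq) in flatten-skip xs (suc i , eq)

-- Ordered field arithmetic and powers of one half.

module RealLemmas (R : Reals) where
  open Reals R
  open CommutativeRing commutativeRing public using (-_; -‿cong; +-identityˡ; +-identityʳ; +-assoc; +-comm;
    -‿inverseˡ; -‿inverseʳ; distribˡ; distribʳ; *-identityˡ; *-identityʳ; *-assoc; *-comm; +-cong;
    *-congˡ; *-congʳ; +-congˡ; +-congʳ; zeroʳ; zeroˡ; ring)
    renaming (refl to ≈-refl; sym to ≈-sym; trans to ≈-trans; reflexive to ≈-reflexive)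
  open RingProperties ring using (-‿distribʳ-*; -‿involutive)
  open SemiringMult semiring using (×1-homo-*)
  open IsTotalOrder isTotalOrder public using (≤-respˡ-≈; ≤-respʳ-≈) renaming
    (refl to ≤-refl; trans to ≤-trans; antisym to ≤-antisym; reflexive to ≤-reflexive; total to ≤-total)

  poset : Poset 0ℓ 0ℓ 0ℓ
  poset = record { isPartialOrder = IsTotalOrder.isPartialOrder isTotalOrder }

  open import Relation.Binary.Reasoning.PartialOrder poset

  +-mono₂-≤ : ∀ {w x y z} → w ≤ x → y ≤ z → w + y ≤ x + z
  +-mono₂-≤ {w} {x} {y} {z} w≤x y≤z = begin
    w + y ≤⟨ +-mono-≤ w y≤z ⟩
    w + z ≈⟨ +-comm w z ⟩
    z + w ≤⟨ +-mono-≤ z w≤x ⟩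
    z + x ≈⟨ +-comm z x ⟩
    x + z ∎

  +-nonneg : ∀ {x y} → 0# ≤ x → 0# ≤ y → 0# ≤ x + y
  +-nonneg {x} {y} p q = ≤-respˡ-≈ (+-identityˡ 0#) (+-mono₂-≤ p q)

  *-monoˡ-≤ : ∀ {c x y} → 0# ≤ c → x ≤ y → c * x ≤ c * y
  *-monoˡ-≤ {c} {x} {y} 0≤c x≤y = begin
    c * x                    ≈⟨ ≈-sym (+-identityʳ _) ⟩
    c * x + 0#               ≤⟨ +-mono-≤ (c * x) (*-nonneg 0≤c (≤-respˡ-≈ (-‿inverseˡ x) (+-mono-≤ (- x) x≤y))) ⟩
    c * x + c * (- x + y)    ≈⟨ ≈-sym (distribˡ c x (- x + y)) ⟩
    c * (x + (- x + y))      ≈⟨ *-congˡ (≈-sym (+-assoc x (- x) y)) ⟩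
    c * (x + - x + y)        ≈⟨ *-congˡ (+-congʳ (-‿inverseʳ x)) ⟩
    c * (0# + y)             ≈⟨ *-congˡ (+-identityˡ y) ⟩
    c * y                    ∎

  0≤1 : 0# ≤ 1#
  0≤1 with ≤-total 0# 1#
  ... | inj₁ p = p
  ... | inj₂ 1≤0 = begin
    0#            ≤⟨ *-nonneg 0≤-1 0≤-1 ⟩
    - 1# * - 1#   ≈⟨ ≈-sym (-‿distribʳ-* (- 1#) 1#) ⟩
    - (- 1# * 1#) ≈⟨ -‿cong (*-identityʳ (- 1#)) ⟩
    - (- 1#)      ≈⟨ -‿involutive 1# ⟩
    1#            ∎
    where
    0≤-1 : 0# ≤ - 1#
    0≤-1 = ≤-respˡ-≈ (-‿inverseˡ 1#) (≤-respʳ-≈ (+-identityʳ (- 1#)) (+-mono-≤ (- 1#) 1≤0))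

  0<1 : 0# < 1#
  0<1 = 0≤1 , 0≉1

  fromℕ-nonneg : ∀ n → 0# ≤ fromℕ n
  fromℕ-nonneg zero    = ≤-refl
  fromℕ-nonneg (suc n) = +-nonneg 0≤1 (fromℕ-nonneg n)

  fromℕ-mono : ∀ {m n} → m ℕ.≤ n → fromℕ m ≤ fromℕ n
  fromℕ-mono {n = n} z≤n = fromℕ-nonneg n
  fromℕ-mono (s≤s p)     = +-mono-≤ 1# (fromℕ-mono p)

  fromℕ-nonzero : ∀ {n} → 0 ℕ.< n → ¬ (fromℕ n ≈ 0#)
  fromℕ-nonzero {suc n} _ eq = 0≉1 (≤-antisym 0≤1 (begin
    1#            ≈⟨ ≈-sym (+-identityʳ 1#) ⟩
    1# + 0#       ≤⟨ +-mono-≤ 1# (fromℕ-nonneg n) ⟩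
    1# + fromℕ n  ≈⟨ eq ⟩
    0#            ∎))

  fromℕ-inverse : ∀ {n} → 0 ℕ.< n → fromℕ n * fromℕ n ⁻¹ ≈ 1#
  fromℕ-inverse {n} 0<n = *-inverse (fromℕ n) (fromℕ-nonzero 0<n)

  fromℕ-inverse-nonneg : ∀ {n} → 0 ℕ.< n → 0# ≤ fromℕ n ⁻¹
  fromℕ-inverse-nonneg {n} 0<n with ≤-total 0# (fromℕ n ⁻¹)
  ... | inj₁ p = p
  ... | inj₂ q = ⊥-elim (0≉1 (≤-antisym 0≤1 (begin
    1#                   ≈⟨ ≈-sym (fromℕ-inverse 0<n) ⟩
    fromℕ n * fromℕ n ⁻¹ ≤⟨ *-monoˡ-≤ (fromℕ-nonneg n) q ⟩
    fromℕ n * 0#         ≈⟨ zeroʳ _ ⟩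
    0#                   ∎)))

  ½-nonneg : ∀ n → 0# ≤ ½^ n
  ½-nonneg zero    = 0≤1
  ½-nonneg (suc n) = *-nonneg (fromℕ-inverse-nonneg {2} z<s) (½-nonneg n)

  2*½ : ∀ n → fromℕ 2 * ½^ (suc n) ≈ ½^ n
  2*½ n = ≈-trans (≈-sym (*-assoc _ _ _)) (≈-trans (*-congʳ (fromℕ-inverse {2} z<s)) (*-identityˡ _))

  ½+½ : ∀ n → ½^ (suc n) + ½^ (suc n) ≈ ½^ n
  ½+½ n = begin-equality
    ½^ (suc n) + ½^ (suc n)                     ≈⟨ +-cong (≈-sym (*-identityˡ _)) (≈-sym (*-identityˡ _)) ⟩
    1# * ½^ (suc n) + 1# * ½^ (suc n)           ≈⟨ ≈-sym (distribʳ _ 1# 1#) ⟩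
    (1# + 1#) * ½^ (suc n)                      ≈⟨ *-congʳ (+-congˡ (≈-sym (+-identityʳ 1#))) ⟩
    fromℕ 2 * ½^ (suc n)                        ≈⟨ 2*½ n ⟩
    ½^ n                                        ∎

  ½-suc-≤ : ∀ n → ½^ (suc n) ≤ ½^ n
  ½-suc-≤ n = begin
    ½^ (suc n)              ≈⟨ ≈-sym (+-identityʳ _) ⟩
    ½^ (suc n) + 0#         ≤⟨ +-mono-≤ _ (½-nonneg (suc n)) ⟩
    ½^ (suc n) + ½^ (suc n) ≈⟨ ½+½ n ⟩
    ½^ n                    ∎

  ½-antitone-+ : ∀ j k → ½^ (j ℕ.+ k) ≤ ½^ k
  ½-antitone-+ zero    k = ≤-refl
  ½-antitone-+ (suc j) k = ≤-trans (½-suc-≤ (j ℕ.+ k)) (½-antitone-+ j k)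

  ½-antitone : ∀ {m n} → m ℕ.≤ n → ½^ n ≤ ½^ m
  ½-antitone {m} {n} m≤n = subst (λ i → ½^ i ≤ ½^ m) (ℕₚ.m∸n+n≡m m≤n) (½-antitone-+ (n ℕ.∸ m) m)

  2^*½^ : ∀ n → fromℕ (2 ℕ.^ n) * ½^ n ≈ 1#
  2^*½^ zero    = ≈-trans (*-identityʳ _) (+-identityʳ 1#)
  2^*½^ (suc n) = begin-equality
    fromℕ (2 ℕ.^ suc n) * ½^ (suc n)             ≈⟨ *-congʳ (≈-trans (×1-homo-* 2 (2 ℕ.^ n)) (*-comm _ _)) ⟩
    fromℕ (2 ℕ.^ n) * fromℕ 2 * ½^ (suc n)       ≈⟨ *-assoc _ _ _ ⟩
    fromℕ (2 ℕ.^ n) * (fromℕ 2 * ½^ (suc n))     ≈⟨ *-congˡ (2*½ n) ⟩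
    fromℕ (2 ℕ.^ n) * ½^ n                       ≈⟨ 2^*½^ n ⟩
    1#                                           ∎

  -- Here y stands for 1/b.
  ratio-≤ : ∀ k {a b y} → 0# ≤ y → fromℕ b * y ≈ 1# → 2 ℕ.^ k ℕ.* a ℕ.≤ b → fromℕ a * y ≤ ½^ k
  ratio-≤ k {a} {b} {y} 0≤y by≈1 le = begin
    fromℕ a * y                                  ≈⟨ ≈-sym (*-identityˡ _) ⟩
    1# * (fromℕ a * y)                           ≈⟨ *-congʳ (≈-trans (≈-sym (2^*½^ k)) (*-comm _ _)) ⟩
    ½^ k * fromℕ (2 ℕ.^ k) * (fromℕ a * y)       ≈⟨ *-assoc _ _ _ ⟩
    ½^ k * (fromℕ (2 ℕ.^ k) * (fromℕ a * y))     ≈⟨ *-congˡ (≈-trans (≈-sym (*-assoc _ _ _)) (*-comm _ _)) ⟩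
    ½^ k * (y * (fromℕ (2 ℕ.^ k) * fromℕ a))     ≈⟨ *-congˡ (*-congˡ (≈-sym (×1-homo-* (2 ℕ.^ k) a))) ⟩
    ½^ k * (y * fromℕ (2 ℕ.^ k ℕ.* a))           ≤⟨ *-monoˡ-≤ (½-nonneg k) (*-monoˡ-≤ 0≤y (fromℕ-mono le)) ⟩
    ½^ k * (y * fromℕ b)                         ≈⟨ *-congˡ (≈-trans (*-comm _ _) by≈1) ⟩
    ½^ k * 1#                                    ≈⟨ *-identityʳ _ ⟩
    ½^ k                                         ∎

  -- The supremum s of the lower bounds of all 2⁻ᵏ satisfies s ≤ s/2.
  archimedean : ∀ {u} → (∀ k → u ≤ ½^ k) → u ≤ 0#
  archimedean {u} u≤½^ = ≤-trans (proj₁ s-lub u u≤½^) s≤0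
    where
    Small : Pred ℝ 0ℓ
    Small x = ∀ k → x ≤ ½^ k
    lub = complete Small (0# , ½-nonneg) (1# , λ x p → p 0)
    s = proj₁ lub
    s-lub = proj₂ lub
    double : ∀ {x} → Small x → Small (x + x)
    double p k = ≤-respʳ-≈ (½+½ k) (+-mono₂-≤ (p (suc k)) (p (suc k)))
    cancel : ∀ x y → - x + (x + y) ≈ y
    cancel x y = ≈-trans (≈-sym (+-assoc _ _ _)) (≈-trans (+-congʳ (-‿inverseˡ x)) (+-identityˡ y))
    -- `Small` is closed under doubling, so `x` is half of the small number `x + x`, which is at
    -- most `s`.
    half-bound : UpperBound _≤_ Small (½^ 1 * s)
    half-bound x p = begin
      x                       ≈⟨ ≈-sym (*-identityˡ x) ⟩
      1# * x                  ≈⟨ *-congʳ (≈-sym (½+½ 0)) ⟩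
      (½^ 1 + ½^ 1) * x       ≈⟨ ≈-trans (distribʳ _ _ _) (≈-sym (distribˡ _ _ _)) ⟩
      ½^ 1 * (x + x)          ≤⟨ *-monoˡ-≤ (½-nonneg 1) (proj₁ s-lub _ (double p)) ⟩
      ½^ 1 * s                ∎
    s≤s/2 : s ≤ ½^ 1 * s
    s≤s/2 = proj₂ s-lub _ half-bound
    s+s≤s : s + s ≤ s
    s+s≤s = begin
      s + s                   ≤⟨ +-mono₂-≤ s≤s/2 s≤s/2 ⟩
      ½^ 1 * s + ½^ 1 * s     ≈⟨ ≈-sym (distribʳ _ _ _) ⟩
      (½^ 1 + ½^ 1) * s       ≈⟨ *-congʳ (½+½ 0) ⟩
      1# * s                  ≈⟨ *-identityˡ s ⟩
      s                       ∎
    s≤0 : s ≤ 0#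
    s≤0 = begin
      s              ≈⟨ ≈-sym (cancel s s) ⟩
      - s + (s + s)  ≤⟨ +-mono-≤ (- s) s+s≤s ⟩
      - s + s        ≈⟨ -‿inverseˡ s ⟩
      0#             ∎

  -- Otherwise δ would be below every power of one half, hence 0 by `archimedean`.
  ∃½^≤ : Classical → ∀ {δ} → 0# < δ → ∃ λ k → ½^ k ≤ δ
  ∃½^≤ em {δ} (0≤δ , 0≉δ) with em 0ℓ {P = ∃ λ k → ½^ k ≤ δ}
  ... | yes p = p
  ... | no ¬p = ⊥-elim (0≉δ (≤-antisym 0≤δ (archimedean λ k → [ id , (λ q → ⊥-elim (¬p (k , q))) ]′ (≤-total δ (½^ k)))))

  -- Both the Lebesgue and the Hausdorff null sets are recognised through this criterion; the level
  -- ℓ differs between the two.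
  ∞-glb-zero : ∀ {ℓ} {P : Pred ℝ∞ ℓ} → (∀ v → v ∈ P → [ 0# ] ≤∞ v) →
    (∀ k → ∃ λ v → v ∈ P × v ≤∞ [ ½^ k ]) → IsGlb _≤∞_ P [ 0# ]
  ∞-glb-zero lower small = lower , greatest
    where
    -- The bound by 1, which is the case `k = 0`, excludes the value ∞, so that `archimedean`
    -- applies.
    finite : ∀ {u} → u ≤∞ [ 1# ] → (∀ k → u ≤∞ [ ½^ k ]) → u ≤∞ [ 0# ]
    finite [ _ ] p = [ archimedean (λ k → [≤]-injective _≤_ (p k)) ]
    greatest : ∀ u → UpperBound (flip _≤∞_) _ u → u ≤∞ [ 0# ]
    greatest u lb = finite (le 0) le
      where
      le : ∀ k → u ≤∞ [ ½^ k ]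
      le k = let (v , v∈P , v≤) = small k in ≤⁺-trans _≤_ ≤-trans (lb v v∈P) v≤

  -- Series with bounded partial sums.

  bounded-series : ∀ {t c} → (∀ n → sum {n} (t ∘ toℕ) ≤ c) → ∃ λ s → IsSum t s × s ≤∞ [ c ]
  bounded-series {t} {c} bounded = [ s ] , ((λ { _ (n , refl) → [ proj₁ s-lub _ (n , refl) ] }) , least)
                                         , [ proj₂ s-lub c upper ]
    where
    upper : UpperBound _≤_ (λ r → ∃ λ n → r ≡ sum {n} (t ∘ toℕ)) c
    upper _ (n , refl) = bounded n
    lub = complete (λ r → ∃ λ n → r ≡ sum {n} (t ∘ toℕ)) (0# , 0 , refl) (c , upper)
    s = proj₁ lub
    s-lub = proj₂ lub
    least : ∀ u → UpperBound _≤∞_ (λ v → ∃ λ n → v ≡ [ sum {n} (t ∘ toℕ) ]) u → [ s ] ≤∞ u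
    least ⊤⁺    ub = _ ≤⊤⁺
    least [ r ] ub = [ proj₂ s-lub r (λ { _ (n , refl) → [≤]-injective _≤_ (ub _ (n , refl)) }) ]

  IsSum-nonneg : ∀ t {s} → IsSum t s → [ 0# ] ≤∞ s
  IsSum-nonneg t is = proj₁ is _ (0 , refl)

  module Weighted (w : A → ℝ) where

    total : List A → ℝ
    total = List.foldr (λ a s → w a + s) 0#

    total-map : ∀ {v} (f : B → A) (xs : List B) → (∀ x → w (f x) ≈ v) →
      total (map f xs) ≈ fromℕ (length xs) * v
    total-map f []       p = ≈-sym (zeroˡ _)
    total-map {v = v} f (x ∷ xs) p = begin-equality
      w (f x) + total (map f xs)            ≈⟨ +-cong (≈-trans (p x) (≈-sym (*-identityˡ v))) (total-map f xs p) ⟩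
      1# * v + fromℕ (length xs) * v        ≈⟨ ≈-sym (distribʳ _ _ _) ⟩
      fromℕ (length (x ∷ xs)) * v           ∎

    module _ (w-nonneg : ∀ a → 0# ≤ w a)
             (hd : ℕ → A) (tl : ℕ → List A) (tail : ℕ → ℝ) (tail-nonneg : ∀ n → 0# ≤ tail n)
             (tail-step : ∀ n → w (hd n) + (total (tl n) + tail (suc n)) ≤ tail n) where

      total-nonneg : ∀ xs → 0# ≤ total xs
      total-nonneg []       = ≤-refl
      total-nonneg (x ∷ xs) = +-nonneg (w-nonneg x) (total-nonneg xs)

      -- `tail n` is a budget for everything from `hd n` on: by `tail-step` it pays for stage `n`
      -- and leaves `tail (suc n)`. The list `xs` is what is still unread of the stage before.
      flatten-partial-sum : ∀ m xs n →
        sum {m} (w ∘ flatten hd tl xs n ∘ toℕ) ≤ total xs + tail n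
      flatten-partial-sum zero    xs       n = +-nonneg (total-nonneg xs) (tail-nonneg n)
      flatten-partial-sum (suc m) []       n = begin
        w (hd n) + sum {m} (w ∘ flatten hd tl (tl n) (suc n) ∘ toℕ)
          ≤⟨ +-mono-≤ _ (flatten-partial-sum m (tl n) (suc n)) ⟩
        w (hd n) + (total (tl n) + tail (suc n))
          ≤⟨ tail-step n ⟩
        tail n
          ≈⟨ ≈-sym (+-identityˡ _) ⟩
        0# + tail n ∎
      flatten-partial-sum (suc m) (x ∷ xs) n = begin
        w x + sum {m} (w ∘ flatten hd tl xs n ∘ toℕ) ≤⟨ +-mono-≤ _ (flatten-partial-sum m xs n) ⟩
        w x + (total xs + tail n)                     ≈⟨ ≈-sym (+-assoc _ _ _) ⟩
        (w x + total xs) + tail n                     ∎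

      flatten-sum : ∀ xs → ∃ λ s → IsSum (w ∘ flatten hd tl xs 0) s × s ≤∞ [ total xs + tail 0 ]
      flatten-sum xs = bounded-series {t = w ∘ flatten hd tl xs 0} (λ m → flatten-partial-sum m xs 0)

-- Prefixes of sequences and powers of 7/8.

prefix : (ℕ → A) → ∀ n → Vec A n
prefix x zero    = []
prefix x (suc n) = x 0 ∷ prefix (x ∘ suc) n

prefix-cong : ∀ {x y : ℕ → A} n → (∀ i → i ℕ.< n → x i ≡ y i) → prefix x n ≡ prefix y n
prefix-cong zero    p = refl
prefix-cong (suc n) p = ≡.cong₂ _∷_ (p 0 z<s) (prefix-cong n (λ i i<n → p (suc i) (s<s i<n)))

prefix-+ : ∀ (x : ℕ → A) m n → prefix x (m ℕ.+ n) ≡ prefix x m Vec.++ prefix (λ i → x (m ℕ.+ i)) n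
prefix-+ x zero    n = refl
prefix-+ x (suc m) n = cong (x 0 ∷_) (prefix-+ (x ∘ suc) m n)

∈-Cylinder-prefix : ∀ x n → x ∈ Cylinder (toList (prefix x n))
∈-Cylinder-prefix x (suc n) zero    = refl
∈-Cylinder-prefix x (suc n) (suc i) = ∈-Cylinder-prefix (x ∘ suc) n i

2^k*a^k≤b^k : ∀ {a b} k → 2 ℕ.* a ℕ.≤ b → 2 ℕ.^ k ℕ.* a ℕ.^ k ℕ.≤ b ℕ.^ k
2^k*a^k≤b^k         zero    _  = ℕₚ.≤-refl
2^k*a^k≤b^k {a} {b} (suc k) le = begin
  2 ℕ.^ suc k ℕ.* a ℕ.^ suc k            ≡⟨ ℕₚ.[m*n]*[o*p]≡[m*o]*[n*p] 2 (2 ℕ.^ k) a (a ℕ.^ k) ⟩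
  2 ℕ.* a ℕ.* (2 ℕ.^ k ℕ.* a ℕ.^ k)      ≤⟨ ℕₚ.*-mono-≤ le (2^k*a^k≤b^k k le) ⟩
  b ℕ.^ suc k                            ∎
  where open ℕₚ.≤-Reasoning

-- 2 (7/8)⁶ ≤ 1
2^k*7^6k≤8^6k : ∀ k → 2 ℕ.^ k ℕ.* 7 ℕ.^ (6 ℕ.* k) ℕ.≤ 8 ℕ.^ (6 ℕ.* k)
2^k*7^6k≤8^6k k = ≡.subst₂ (λ a b → 2 ℕ.^ k ℕ.* a ℕ.≤ b) (ℕₚ.^-*-assoc 7 6 k) (ℕₚ.^-*-assoc 8 6 k)
  (2^k*a^k≤b^k k (ℕₚ.≤ᵇ⇒≤ (2 ℕ.* 7 ℕ.^ 6) (8 ℕ.^ 6) tt))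

-- Closed null sets cut out block by block.

module Blocks (size : ℕ → ℕ) where

  offset : ℕ → ℕ
  offset zero    = 0
  offset (suc n) = offset n ℕ.+ size n

  block : (ℕ → A) → ∀ n → Vec A (size n)
  block x n = prefix (λ i → x (offset n ℕ.+ i)) (size n)

  block-cong : ∀ {x y : ℕ → A} n → (∀ i → i ℕ.< offset (suc n) → x i ≡ y i) → block x n ≡ block y n
  block-cong n p = prefix-cong (size n) (λ i i<k → p _ (ℕₚ.+-monoʳ-< (offset n) i<k))

  module Confined (R : Reals) (allowed : ∀ n → List (Vec Bool (size n)))
                  (sparse : ∀ n → 8 ℕ.* length (allowed n) ℕ.≤ 7 ℕ.* 2 ℕ.^ size n) (n₀ : ℕ) where
    open Reals R
    open RealLemmas R

    -- With the index written `m + n₀`, the length `offset (suc m + n₀)` unfolds by computation, as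
    -- the type of `words` requires.
    Confined : Pred Cantor 0ℓ
    Confined x = ∀ m → block x (m ℕ.+ n₀) ∈ₗ allowed (m ℕ.+ n₀)

    -- A violation shows in a single block, which depends on finitely many coordinates only.
    Confined-closed : Classical → IsClosed Confined
    Confined-closed em x x∉ with em 0ℓ {P = ∃ λ m → ¬ (block x (m ℕ.+ n₀) ∈ₗ allowed (m ℕ.+ n₀))}
    ... | yes (m , ∉) = offset (suc (m ℕ.+ n₀)) , λ y x≡y y∈ →
      ∉ (subst (_∈ₗ allowed (m ℕ.+ n₀)) (≡.sym (block-cong (m ℕ.+ n₀) x≡y)) (y∈ m))
    ... | no ∄ = ⊥-elim (x∉ λ m → decidable-stable (em 0ℓ) (λ ∉ → ∄ (m , ∉)))

    words : ∀ m → List (Vec Bool (offset (m ℕ.+ n₀)))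
    words zero    = allBits (offset n₀)
    words (suc m) = cartesianProductWith Vec._++_ (words m) (allowed (m ℕ.+ n₀))

    ∈-words : ∀ m {x} → Confined x → prefix x (offset (m ℕ.+ n₀)) ∈ₗ words m
    ∈-words zero    x∈ = ∈-allBits _
    ∈-words (suc m) {x} x∈ = subst (_∈ₗ words (suc m))
      (≡.sym (prefix-+ x (offset (m ℕ.+ n₀)) (size (m ℕ.+ n₀))))
      (∈-cartesianProductWith⁺ Vec._++_ (∈-words m {x} x∈) (x∈ m))

    -- The words have density at most (7/8)ᵐ, each constrained block contributing a factor 7/8 by
    -- `sparse`; denominators are cleared to stay in ℕ.
    length-words : ∀ m → 8 ℕ.^ m ℕ.* length (words m) ℕ.≤ 7 ℕ.^ m ℕ.* 2 ℕ.^ offset (m ℕ.+ n₀)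
    length-words zero    = ℕₚ.≤-reflexive (cong (1 ℕ.*_) (length-allBits (offset n₀)))
    length-words (suc m) = begin
      8 ℕ.^ suc m ℕ.* length (words (suc m))
        ≡⟨ cong (8 ℕ.^ suc m ℕ.*_) (length-cartesianProductWith Vec._++_ (words m) (allowed (m ℕ.+ n₀))) ⟩
      8 ℕ.^ suc m ℕ.* (length (words m) ℕ.* length (allowed (m ℕ.+ n₀)))
        ≡⟨ solve 4 (λ b p x y → b :* p :* (x :* y) := p :* x :* (b :* y)) refl
             8 (8 ℕ.^ m) (length (words m)) (length (allowed (m ℕ.+ n₀))) ⟩
      8 ℕ.^ m ℕ.* length (words m) ℕ.* (8 ℕ.* length (allowed (m ℕ.+ n₀)))
        ≤⟨ ℕₚ.*-mono-≤ (length-words m) (sparse (m ℕ.+ n₀)) ⟩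
      7 ℕ.^ m ℕ.* 2 ℕ.^ L ℕ.* (7 ℕ.* 2 ℕ.^ l)
        ≡⟨ solve 4 (λ b p x y → p :* x :* (b :* y) := b :* p :* (x :* y)) refl
             7 (7 ℕ.^ m) (2 ℕ.^ L) (2 ℕ.^ l) ⟩
      7 ℕ.^ suc m ℕ.* (2 ℕ.^ L ℕ.* 2 ℕ.^ l)
        ≡⟨ cong (7 ℕ.^ suc m ℕ.*_) (≡.sym (ℕₚ.^-distribˡ-+-* 2 L l)) ⟩
      7 ℕ.^ suc m ℕ.* 2 ℕ.^ (L ℕ.+ l) ∎
      where
      open ℕₚ.≤-Reasoning
      open +-*-Solver
      L = offset (m ℕ.+ n₀)
      l = size (m ℕ.+ n₀)

    -- Six constrained blocks at least halve the density, so 6k of them bring it down to 2⁻ᵏ. The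
    -- factor 7ᵐ is inserted to chain the two estimates and then cancelled.
    few-words : ∀ k → 2 ℕ.^ k ℕ.* length (words (6 ℕ.* k)) ℕ.≤ 2 ℕ.^ offset (6 ℕ.* k ℕ.+ n₀)
    few-words k = ℕₚ.*-cancelˡ-≤ (7 ℕ.^ m) {{ℕₚ.m^n≢0 7 m}} (begin
      7 ℕ.^ m ℕ.* (2 ℕ.^ k ℕ.* length (words m)) 
        ≡⟨ solve 3 (λ p q x → p :* (q :* x) := q :* p :* x)
             refl (7 ℕ.^ m) (2 ℕ.^ k) (length (words m)) ⟩
      2 ℕ.^ k ℕ.* 7 ℕ.^ m ℕ.* length (words m)    ≤⟨ ℕₚ.*-monoˡ-≤ (length (words m)) (2^k*7^6k≤8^6k k) ⟩
      8 ℕ.^ m ℕ.* length (words m)                ≤⟨ length-words m ⟩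
      7 ℕ.^ m ℕ.* 2 ℕ.^ offset (m ℕ.+ n₀)         ∎)
      where
      open ℕₚ.≤-Reasoning
      open +-*-Solver
      m = 6 ℕ.* k

    Confined-null : Lebesgue.LebesgueNull R Confined
    Confined-null = ∞-glb-zero (λ { v (s , _ , is) → IsSum-nonneg (λ n → ½^ length (s n)) is }) small
      where
      open Weighted (λ s → ½^ length s)
      small : ∀ k → ∃ λ v → (∃ λ (s : ℕ → List Bool) →
        Confined ⊆ ⋃ ℕ (Cylinder ∘ s) × IsSum (λ n → ½^ length (s n)) v) × v ≤∞ [ ½^ k ]
      small k = v , (flatten padding (const []) cover 0 , (λ {x} → covers {x}) , is) , ≤⁺-trans _≤_ ≤-trans v≤ [ bound ]
        where
        -- The words and the padding get half of the budget 2⁻ᵏ each.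
        m = 6 ℕ.* suc k
        L = offset (m ℕ.+ n₀)
        -- Covers are infinite sequences and no cylinder has weight 0, so the finite list of words
        -- is continued by ever longer strings, of total weight 2⁻⁽ᵏ⁺¹⁾.
        padding : ℕ → List Bool
        padding j = replicate (suc (j ℕ.+ suc k)) true
        cover : List (List Bool)
        cover = map toList (words m)
        padding-step : ∀ j → ½^ length (padding j) + (0# + ½^ (suc (j ℕ.+ suc k))) ≤ ½^ (j ℕ.+ suc k)
        padding-step j = ≤-reflexive (≈-trans (+-cong (≈-reflexive (cong ½^_ (length-replicate (suc (j ℕ.+ suc k)))))
          (+-identityˡ _)) (½+½ (j ℕ.+ suc k)))
        sums = flatten-sum (λ s → ½-nonneg (length s)) padding (const [])
          (λ j → ½^ (j ℕ.+ suc k)) (λ j → ½-nonneg (j ℕ.+ suc k)) padding-step cover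
        v  = proj₁ sums
        is = proj₁ (proj₂ sums)
        v≤ = proj₂ (proj₂ sums)
        bound : total cover + ½^ suc k ≤ ½^ k
        bound = ≤-respʳ-≈ (½+½ k) (+-mono₂-≤
          (≤-respˡ-≈ (≈-sym (total-map toList (words m) (λ u → ≈-reflexive (cong ½^_ (length-toList u)))))
            (ratio-≤ (suc k) (½-nonneg L) (2^*½^ L) (few-words (suc k))))
          ≤-refl)
        covers : Confined ⊆ ⋃ ℕ (Cylinder ∘ flatten padding (const []) cover 0)
        covers {x} x∈ =
          let (i , eq) = flatten-here padding (const []) (∈-map⁺ toList (∈-words m {x} x∈))
          in i , subst (λ s → x ∈ Cylinder s) (≡.sym eq) (∈-Cylinder-prefix x L)

-- Consequences of non-colourability.

module DaviesRogersGraph {R : Reals} {n : ℕ} {G : Graph} (isDR : IsDaviesRogersGraph R n G) where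
  open Graph G
  open IsDaviesRogersGraph isDR

  -- Empty parts would partition an empty graph.
  order-positive : 0 ℕ.< order
  order-positive with order ℕₚ.≟ 0
  ... | no  ≢0 = ℕₚ.n≢0⇒n>0 ≢0
  ... | yes ≡0 = ⊥-elim (no-partition ((λ _ → Sub.⊥) , (λ _ u∈ → ⊥-elim (∉⊥ u∈)) , λ v → ⊥-elim (absurd v)))
    where
    absurd : ¬ Vertex
    absurd v with subst Fin ≡0 v
    ... | ()

  -- In a graph without edges the whole vertex set is independent, and together with empty parts it
  -- would be a forbidden partition. The edge serves to attain diameters in `Piece-diam`.
  has-edge : Classical → 0 ℕ.< n → ∃₂ λ u v → u ~ v
  has-edge em (s≤s {n = n′} _) with em 0ℓ {P = ∃₂ λ u v → u ~ v}
  ... | yes e = e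
  ... | no ¬e = ⊥-elim (no-partition (P , independent , unique))
    where
    P : Fin (suc n′) → Subset order
    P zero    = Sub.⊤
    P (suc _) = Sub.⊥
    independent : ∀ i → Independent (P i)
    independent i {u} {v} _ _ u~v = ¬e (u , v , u~v)
    unique : ∀ v → ∃! _≡_ λ i → v Sub.∈ P i
    unique v = zero , ∈⊤ , λ { {zero} _ → refl ; {suc j} v∈ → ⊥-elim (∉⊥ v∈) }

-- Points of the Davies-Rogers space and their prefixes.

module DaviesRogersSpace (em : Classical) (R : Reals) (D : DaviesRogers R) where
  open Reals R
  open RealLemmas R
  open DaviesRogers D hiding (Ω-setoid; 𝓝)
  open IsMetricρ isρ
  open IsGaugeh ish
  open Graph using (order; Vertex; Independent)

  mutual
    -- Positivity of `M (suc n)` needs `G n` to be nonempty, which is known only once `M n` is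
    -- positive; hence the mutual recursion.
    M-positive : ∀ n → 0 ℕ.< M n
    M-positive zero    = z<s
    M-positive (suc n) = ℕₚ.≤-trans (DaviesRogersGraph.order-positive (G-isDR n)) (ℕₚ.m≤m+n _ _)

    G-isDR : ∀ n → IsDaviesRogersGraph R (M n) (G n)
    G-isDR n = isGraph (M n) (M-positive n)

  M-product-positive : ∀ n → 0 ℕ.< M-product n
  M-product-positive zero    = z<s
  M-product-positive (suc n) = ℕₚ.*-mono-< (M-product-positive n) (M-positive (suc n))

  origin : Ω
  origin n = fromℕ< (DaviesRogersGraph.order-positive (G-isDR n))

  update : Ω → ∀ n → Vertex (G n) → Ω
  update x n v i with i ℕₚ.≟ n
  ... | yes refl = v
  ... | no  _    = x i

  update-same : ∀ x n v → update x n v n ≡ v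
  update-same x n v with n ℕₚ.≟ n
  ... | yes refl = refl
  ... | no  n≢n  = ⊥-elim (n≢n refl)

  update-other : ∀ x {n i} v → i ≢ n → update x n v i ≡ x i
  update-other x {n} {i} v i≢n with i ℕₚ.≟ n
  ... | yes i≡n = ⊥-elim (i≢n i≡n)
  ... | no  _   = refl

  _≡[_]_ : Ω → ℕ → Ω → Set
  x ≡[ n ] y = ∀ i → i ℕ.< n → x i ≡ y i

  extend : ∀ {n x y} → x ≡[ n ] y → x n ≡ y n → x ≡[ suc n ] y
  extend x≡y xn≡yn i i<1+n with ℕₚ.m≤n⇒m<n∨m≡n (ℕ.s≤s⁻¹ i<1+n)
  ... | inj₁ i<n  = x≡y i i<n
  ... | inj₂ refl = xn≡yn

  -- A prefix of length `n` is encoded as the point that continues it along `origin`, which avoids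
  -- dependent tuples.
  representatives : ℕ → List Ω
  representatives zero    = origin ∷ []
  representatives (suc n) = cartesianProductWith (λ x v → update x n v) (representatives n) (allFin (order (G n)))

  ∈-representatives : ∀ n y → ∃ λ x → x ∈ₗ representatives n × y ≡[ n ] x
  ∈-representatives zero    y = origin , here refl , λ _ ()
  ∈-representatives (suc n) y = let (x , x∈ , y≡x) = ∈-representatives n y in
    update x n (y n) ,
    ∈-cartesianProductWith⁺ (λ x v → update x n v) x∈ (∈-allFin (y n)) ,
    extend (λ i i<n → ≡.trans (y≡x i i<n) (≡.sym (update-other x (y n) (ℕₚ.<⇒≢ i<n))))
           (≡.sym (update-same x n (y n)))

  -- Each factor Mᵢ₊₁ = 2Nᵢ supplies one 2, and M₀ is 1. This power of 2 is what makes the sums of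
  -- `h` small.
  length-representatives : ∀ n → 2 ℕ.^ n ℕ.* length (representatives n) ≡ M-product n
  length-representatives zero    = refl
  length-representatives (suc n) = begin
    2 ℕ.^ suc n ℕ.* length (representatives (suc n))
      ≡⟨ cong (2 ℕ.^ suc n ℕ.*_) (≡.trans
           (length-cartesianProductWith (λ x v → update x n v) (representatives n) (allFin (order (G n))))
           (cong (length (representatives n) ℕ.*_) (length-tabulate {n = order (G n)} id))) ⟩
    2 ℕ.^ suc n ℕ.* (length (representatives n) ℕ.* order (G n))
      ≡⟨ solve 3 (λ p l o → con 2 :* p :* (l :* o) := p :* l :* (con 2 :* o))
             refl (2 ℕ.^ n) (length (representatives n)) (order (G n)) ⟩
    2 ℕ.^ n ℕ.* length (representatives n) ℕ.* M (suc n)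
      ≡⟨ cong (ℕ._* M (suc n)) (length-representatives n) ⟩
    M-product (suc n) ∎
    where
    open ≡.≡-Reasoning
    open +-*-Solver

  -- Distance estimates.

  least-difference : ∀ x y → (∀ n → x n ≡ y n) ⊎ ∃ (LeastDifference x y)
  least-difference x y with em 0ℓ {P = ∃ (LeastDifference x y)}
  ... | yes d = inj₂ d
  ... | no ∄ = inj₁ λ n → agree (suc n) n ℕₚ.≤-refl
    where
    agree : ∀ n → x ≡[ n ] y
    agree zero    _ ()
    agree (suc n) = extend (agree n) (decidable-stable (em 0ℓ) λ xn≢yn → ∄ (n , agree n , xn≢yn))

  -- A first difference comes at `n + 1` or later, so even the doubled distance of adjacent vertices
  -- is at most 2⁻ⁿ.
  ρ-agree-≤ : ∀ {n x y} → x ≡[ suc n ] y → ρ x y ≤ ½^ n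
  ρ-agree-≤ {n} {x} {y} x≡y with least-difference x y
  ... | inj₁ all = ≤-respˡ-≈ (≈-sym (ρ-equal all)) (½-nonneg n)
  ... | inj₂ (m , ld) with ℕₚ.<-≤-connex m (suc n)
  ...   | inj₁ m<1+n = ⊥-elim (proj₂ ld (x≡y m m<1+n))
  ...   | inj₂ (s≤s {n = m} n≤m) with em 0ℓ {P = Graph._~_ (G (suc m)) (x (suc m)) (y (suc m))}
  ...     | yes x~y = ≤-respˡ-≈ (≈-sym (≈-trans (ρ-adjacent ld x~y) (2*½ m))) (½-antitone n≤m)
  ...     | no ¬x~y = ≤-respˡ-≈ (≈-sym (ρ-nonadjacent ld ¬x~y)) (½-antitone (ℕₚ.m≤n⇒m≤1+n n≤m))

  -- Points that differ at `n` have distinct vertices of an independent set there, so the distance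
  -- is not doubled.
  ρ-independent-≤ : ∀ {n x y S} → Independent (G n) S → x ≡[ n ] y → x n Sub.∈ S → y n Sub.∈ S → ρ x y ≤ ½^ n
  ρ-independent-≤ {n} {x} {y} ind x≡y xn∈ yn∈ with em 0ℓ {P = x n ≡ y n}
  ... | yes xn≡yn = ρ-agree-≤ (extend x≡y xn≡yn)
  ... | no  xn≢yn = ≤-reflexive (ρ-nonadjacent (x≡y , xn≢yn) (ind xn∈ yn∈))

  H : ∀ n → Vertex (G n) → Subset (order (G n))
  H n = proj₁ (IsDaviesRogersGraph.independent-family (G-isDR n))

  H-independent : ∀ n v → Independent (G n) (H n v)
  H-independent n = proj₁ (proj₂ (IsDaviesRogersGraph.independent-family (G-isDR n)))

  ∈-H : ∀ n v → v Sub.∈ H n v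
  ∈-H n = proj₁ (proj₂ (proj₂ (IsDaviesRogersGraph.independent-family (G-isDR n))))

  H⁻¹ : ∀ n → Vertex (G n) → Subset (order (G n))
  H⁻¹ n a = Vec.tabulate λ v → Vec.lookup (H n v) a

  H⁻¹-large : ∀ n a → order (G n) ℕ.≤ 4 ℕ.* ∣ H⁻¹ n a ∣
  H⁻¹-large n = proj₂ (proj₂ (proj₂ (IsDaviesRogersGraph.independent-family (G-isDR n))))

  ∈-H⁻¹⇒∈-H : ∀ {n v a} → v Sub.∈ H⁻¹ n a → a Sub.∈ H n v
  ∈-H⁻¹⇒∈-H {n} {v} {a} v∈ = lookup⇒[]= a (H n v)
    (≡.trans (≡.sym (lookup∘tabulate (λ v → Vec.lookup (H n v) a) v)) ([]=⇒lookup v∈))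

  Captured : Ω → Pred Ω 0ℓ
  Captured z y = ∀ n₀ → ∃ λ n → n₀ ℕ.≤ n × y n Sub.∈ H n (z n)

  open Hausdorff R ρ h

  -- Captured points form a Hausdorff null set.

  module _ (z : Ω) where

    Piece : ℕ → Ω → Pred Ω 0ℓ
    Piece n p y = y ≡[ n ] p × y n Sub.∈ H n (z n)

    -- The diameter is attained by two points that first differ in an edge of G (suc n).
    Piece-diam : ∀ n p → IsDiam (Piece n p) (½^ n)
    Piece-diam n p = upper , λ u ub → ub (½^ n)
      (inj₂ (a , b , in-piece , in-piece , ≈-sym (≈-trans (ρ-adjacent ld adjacent) (2*½ n))))
      where
      upper : UpperBound _≤_ _ (½^ n)
      upper r (inj₁ r≈0) = ≤-respˡ-≈ (≈-sym r≈0) (½-nonneg n)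
      upper r (inj₂ (x , y , (x≡p , x∈) , (y≡p , y∈) , r≈ρ)) = ≤-respˡ-≈ (≈-sym r≈ρ)
        (ρ-independent-≤ (H-independent n (z n)) (λ i i<n → ≡.trans (x≡p i i<n) (≡.sym (y≡p i i<n))) x∈ y∈)
      edge = DaviesRogersGraph.has-edge (G-isDR (suc n)) em (M-positive (suc n))
      u = proj₁ edge
      v = proj₁ (proj₂ edge)
      -- Coordinate `n` is set to `z n`, which lies in `H n (z n)`, to stay in the piece; the edge
      -- then goes into the free coordinate `n + 1`, where adjacency gives distance 2 · 2⁻⁽ⁿ⁺¹⁾ =
      -- 2⁻ⁿ.
      c : Ω
      c = update p n (z n)
      a b : Ω
      a = update c (suc n) u
      b = update c (suc n) v
      in-piece : ∀ {w} → update c (suc n) w ∈ Piece n p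
      in-piece {w} =
        (λ i i<n → ≡.trans (update-other c w (ℕₚ.<⇒≢ (ℕₚ.m<n⇒m<1+n i<n))) (update-other p (z n) (ℕₚ.<⇒≢ i<n))) ,
        subst (Sub._∈ H n (z n)) (≡.sym (≡.trans (update-other c {i = n} w (ℕₚ.<⇒≢ ℕₚ.≤-refl)) (update-same p n (z n))))
          (∈-H n (z n))
      adjacent : Graph._~_ (G (suc n)) (a (suc n)) (b (suc n))
      adjacent = ≡.subst₂ (Graph._~_ (G (suc n))) (≡.sym (update-same c (suc n) u))
        (≡.sym (update-same c (suc n) v)) (proj₂ (proj₂ edge))
      ld : LeastDifference a b (suc n)
      ld = (λ i i<1+n → ≡.trans (update-other c u (ℕₚ.<⇒≢ i<1+n)) (≡.sym (update-other c v (ℕₚ.<⇒≢ i<1+n)))) ,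
        λ a≡b → Graph.~-irrefl (G (suc n)) (subst (Graph._~_ (G (suc n)) (a (suc n))) (≡.sym a≡b) adjacent)

    module Cover (c : ℕ) where

      -- Starting at level `c + 1` makes the numbers 2 to the power `- level j` add up to 2⁻ᶜ.
      level : ℕ → ℕ
      level j = suc (j ℕ.+ c)

      -- `nothing` is the separator between the stages of `flatten`: the empty set has diameter 0
      -- and costs nothing.
      set : Maybe (ℕ × Ω) → Pred Ω 0ℓ
      set nothing        = ∅
      set (just (j , p)) = Piece (level j) p

      diam : Maybe (ℕ × Ω) → ℝ
      diam nothing        = 0#
      diam (just (j , _)) = ½^ level j

      isDiam : ∀ a → IsDiam (set a) (diam a)
      isDiam nothing        = (λ { _ (inj₁ r≈0) → ≤-reflexive r≈0 ; _ (inj₂ (_ , _ , () , _)) }) , λ _ ub → ub 0# (inj₁ ≈-refl)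
      isDiam (just (j , p)) = Piece-diam (level j) p

      diam-≤ : ∀ a → diam a ≤ ½^ c
      diam-≤ nothing        = ½-nonneg c
      diam-≤ (just (j , _)) = ½-antitone-+ (suc j) c

      h-diam-nonneg : ∀ a → 0# ≤ h (diam a)
      h-diam-nonneg nothing        = ≤-reflexive (≈-sym (h-zero ≈-refl))
      h-diam-nonneg (just (j , _)) = ≤-respʳ-≈ (≈-sym (h-power (level j))) (fromℕ-inverse-nonneg (M-product-positive (level j)))

      stage : ℕ → List (Maybe (ℕ × Ω))
      stage j = map (λ p → just (j , p)) (representatives (level j))

      open Weighted (h ∘ diam)

      -- By `length-representatives` the pieces of level `l` number M₀⋯Mₗ / 2ˡ, and `h` gives each
      -- 1/(M₀⋯Mₗ), in total 2⁻ˡ. For `l = level j` this is half of the budget 2⁻⁽ʲ⁺ᶜ⁾; the other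
      -- half is left for later stages.
      stage-step : ∀ j → h 0# + (total (stage j) + ½^ (suc j ℕ.+ c)) ≤ ½^ (j ℕ.+ c)
      stage-step j = ≤-respʳ-≈ (≈-trans (+-identityˡ _) (½+½ (j ℕ.+ c)))
        (+-mono₂-≤ (≤-reflexive (h-zero ≈-refl)) (+-mono₂-≤
          (≤-respˡ-≈ (≈-sym (total-map (λ p → just (j , p)) (representatives (level j)) (λ _ → h-power (level j))))
            (ratio-≤ (level j) (fromℕ-inverse-nonneg (M-product-positive (level j)))
              (fromℕ-inverse (M-product-positive (level j))) (ℕₚ.≤-reflexive (length-representatives (level j)))))
          ≤-refl))

      cover : ℕ → Maybe (ℕ × Ω)
      cover = flatten (const nothing) stage [] 0

      covers : Captured z ⊆ ⋃ ℕ (set ∘ cover)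
      -- The first stage has level `c + 1`, so a capture at that index or later is requested.
      covers {y} y∈ with y∈ (suc c)
      ... | suc n , s≤s c≤n , yn∈ =
        let (p , p∈ , y≡p) = ∈-representatives (suc n) y
            j+c≡n = ℕₚ.m∸n+n≡m c≤n
            (i , eq) = flatten-there (const nothing) stage j {xs = []} (∈-map⁺ (λ p → just (j , p))
              (subst (λ m → p ∈ₗ representatives (suc m)) (≡.sym j+c≡n) p∈)) (ℕₚ.+-identityʳ j)
        in i , subst (λ a → y ∈ set a) (≡.sym eq) (subst (λ m → y ∈ Piece (suc m) p) (≡.sym j+c≡n) (y≡p , yn∈))
        where j = n ℕ.∸ c

      cover-sum : ∃ λ s → IsSum (h ∘ diam ∘ cover) s × s ≤∞ [ ½^ c ]
      cover-sum = let (s , is , s≤) = flatten-sum h-diam-nonneg (const nothing) stage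
                        (λ j → ½^ (j ℕ.+ c)) (λ j → ½-nonneg (j ℕ.+ c)) stage-step []
                  in s , is , ≤⁺-trans _≤_ ≤-trans s≤ [ ≤-reflexive (+-identityˡ _) ]

    -- The bound for subsets `B` serves the second inequality, where an arbitrary set of captured
    -- points has to be null.
    Captured-null : ∀ {B} → B ⊆ Captured z → 𝓝 D B
    Captured-null {B} B⊆ = const [ 0# ] , glb , (λ { _ (_ , _ , refl) → [ ≤-refl ] }) , λ u ub → ub _ (1# , 0<1 , refl)
      where
      glb : ∀ δ → 0# < δ → IsHausdorffδ δ B [ 0# ]
      glb δ 0<δ = ∞-glb-zero (λ { v (_ , d , _ , _ , is) → IsSum-nonneg (h ∘ d) is }) small
        where
        small : ∀ k → ∃ λ v → CoverSum δ B v × v ≤∞ [ ½^ k ]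
        small k =
          let (k₀ , ½^k₀≤δ) = ∃½^≤ em 0<δ
              -- `k` makes the sum small and `k₀` keeps the diameters below δ.
              open Cover (k ℕ.+ k₀)
              (s , is , s≤) = cover-sum
          in s , (set ∘ cover , diam ∘ cover , (λ y∈ → covers (B⊆ y∈)) ,
                  (λ n → isDiam (cover n) , ≤-trans (diam-≤ (cover n)) (≤-trans (½-antitone-+ k k₀) ½^k₀≤δ)) , is) ,
             ≤⁺-trans _≤_ ≤-trans s≤ [ ½-antitone (ℕₚ.m≤m+n k k₀) ]

  -- Reading bit sequences as points of Ω.

  code : ∀ n → BlockCode (order (G n))
  code n = blockCode (origin n)

  open Blocks (λ n → BlockCode.size (code n))

  point : Cantor → Ω
  point x n = BlockCode.symbol (code n) (block x n)

  point-cong : ∀ {x y : Cantor} → (∀ i → x i ≡ y i) → ∀ n → point x n ≡ point y n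
  point-cong x≡y n = cong (BlockCode.symbol (code n)) (block-cong n (λ i _ → x≡y i))

  -- Points are equal when they agree at every coordinate, so the relation must be shown to respect
  -- this before it can define maps of setoids.
  Captured-resp : ∀ {z z′ y y′} → (∀ n → z n ≡ z′ n) → (∀ n → y n ≡ y′ n) → y ∈ Captured z → y′ ∈ Captured z′
  Captured-resp z≡ y≡ y∈ n₀ = let (n , n₀≤n , yn∈) = y∈ n₀ in
    n , n₀≤n , ≡.subst₂ (λ a b → a Sub.∈ H n b) (y≡ n) (z≡ n) yn∈

  -- If the capture of `y` fails from `n₀` on, then every later block of `x` misses `H⁻¹ n (y n)`;
  -- the closed null sets `Confined n₀` therefore cover `A`.
  not-captured-𝓔 : ∀ y {A} → (∀ x → x ∈ A → ¬ Captured (point x) y) → 𝓔 R A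
  not-captured-𝓔 y A⊆ = subset missed (union Confined λ n₀ → generator (Confined-closed n₀ em , Confined-null n₀))
    where
    -- `H⁻¹ n (y n)` has density at least 1/4 by clause (3), so at most 7/8 of the strings miss it.
    open Confined R (λ n → BlockCode.miss (code n) (H⁻¹ n (y n)))
      (λ n → BlockCode.∣miss∣ (code n) {H⁻¹ n (y n)} (H⁻¹-large n (y n)))
    missed : _ ⊆ ⋃ ℕ Confined
    missed {x} x∈ with em 0ℓ {P = ∃ λ n₀ → ∀ n → n₀ ℕ.≤ n → ¬ (y n Sub.∈ H n (point x n))}
    ... | yes (n₀ , ∉) = n₀ , λ m → BlockCode.∈-miss (code (m ℕ.+ n₀))
            λ ∈H⁻¹ → ∉ (m ℕ.+ n₀) (ℕₚ.m≤n+m n₀ m) (∈-H⁻¹⇒∈-H {m ℕ.+ n₀} ∈H⁻¹)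
    ... | no ∄ = ⊥-elim (A⊆ x x∈ λ n₀ → decidable-stable (em 0ℓ) λ ∄n → ∄ (n₀ , λ n n₀≤n yn∈ → ∄n (n , n₀≤n , yn∈)))

-- From a relation with small sections to a cardinal inequality.

cov≲non : Classical → AxiomOfChoice → (S T : Setoid 0ℓ 0ℓ) →
  let X = Setoid.Carrier S ; Y = Setoid.Carrier T in
  (𝓘 : Pred (Pred X 0ℓ) (lsuc 0ℓ)) (𝓙 : Pred (Pred Y 0ℓ) (lsuc 0ℓ))
  (φ : Y → Pred X 0ℓ) → (∀ {y y′} → Setoid._≈_ T y y′ → φ y ≐ φ y′) → (∀ y → φ y ∈ 𝓘) →
  (∀ x {B} → (∀ y → y ∈ B → x ∉ φ y) → B ∈ 𝓙) →
  (κ : Setoid (lsuc 0ℓ) 0ℓ) (μ : Setoid 0ℓ 0ℓ) → IsCov S 𝓘 κ → IsNon T 𝓙 μ → κ ≲ μ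
cov≲non em choice S T 𝓘 𝓙 φ φ-cong φ∈𝓘 avoid κ μ (_ , minimal) ((A , A∉𝓙 , μ≅A) , _) =
  -- κ is at most the number of sets `φ y` with `y ∈ A`, which is at most the size μ of `A`.
  injection (minimal Image (image⊆𝓘 , covering)) (injection image≲A (Inverse⇒Injection (inverse-sym μ≅A)))
  where
  X = Setoid.Carrier S
  Image : Pred (Pred X 0ℓ) (lsuc 0ℓ)
  Image B = ∃ λ y → y ∈ A × B ≡ φ y
  image⊆𝓘 : Image ⊆ 𝓘
  image⊆𝓘 (y , _ , refl) = φ∈𝓘 y
  covering : ∀ x → ∃ λ B → B ∈ Image × x ∈ B
  covering x with em 0ℓ {P = ∃ λ y → y ∈ A × x ∈ φ y}
  ... | yes (y , y∈A , x∈φy) = φ y , (y , y∈A , refl) , x∈φy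
  -- A point `x` outside all these sets would put `A` into 𝓙.
  ... | no ∄ = ⊥-elim (A∉𝓙 (avoid x λ y y∈A x∈φy → ∄ (y , y∈A , x∈φy)))
  onto : Surjection (∥_∥ {S = T} A) (∥_∥ {S = PowerSetoid X} Image)
  onto = record
    { to = λ { (y , y∈A) → φ y , y , y∈A , refl }
    ; cong = φ-cong
    ; surjective = λ { (_ , y , y∈A , refl) → (y , y∈A) , φ-cong }
    }
  -- Different `y` may give the same set, so choice picks one for each; it is injective because `φ`
  -- recovers the set from the chosen `y`.
  section = choice (∥_∥ {S = T} A) (∥_∥ {S = PowerSetoid X} Image) onto
  image≲A : ∥_∥ {S = PowerSetoid X} Image ≲ ∥_∥ {S = T} A
  image≲A = record
    { to = Func.to (proj₁ section)
    ; cong = Func.cong (proj₁ section)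
    ; injective = λ {B} {C} eq → P.trans {i = proj₁ B} (P.sym (proj₂ section B))
        (P.trans {j = proj₁ (Surjection.to onto (Func.to (proj₁ section) C))} (φ-cong eq) (proj₂ section C))
    }
    where module P = Setoid (PowerSetoid X)

theorem15 : Classical → AxiomOfChoice →
    (R : Reals) (D : DaviesRogers R) →
    ((κ : Setoid (lsuc 0ℓ) 0ℓ) (μ : Setoid 0ℓ 0ℓ) →
    IsCov (Ω-setoid D) (𝓝 D) κ → IsNon Cantor-setoid (𝓔 R) μ → κ ≲ μ)
    ×
    ((κ : Setoid (lsuc 0ℓ) 0ℓ) (μ : Setoid 0ℓ 0ℓ) →
    IsCov Cantor-setoid (𝓔 R) κ → IsNon (Ω-setoid D) (𝓝 D) μ → κ ≲ μ)
theorem15 em choice R D =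
    cov≲non em choice (Ω-setoid D) Cantor-setoid (𝓝 D) (𝓔 R)
      (λ x → Captured (point x))
      (λ x≡ → Captured-resp (point-cong x≡) (λ _ → refl) , Captured-resp (point-cong (≡.sym ∘ x≡)) (λ _ → refl))
      (λ x → Captured-null (point x) id)
      not-captured-𝓔
  , cov≲non em choice Cantor-setoid (Ω-setoid D) (𝓔 R) (𝓝 D)
      -- The dual relation: the roles of the two spaces are exchanged and the relation is negated.
      (λ y x → ¬ Captured (point x) y)
      (λ y≡ → (λ ∉ ∈ → ∉ (Captured-resp (λ _ → refl) (≡.sym ∘ y≡) ∈)) , (λ ∉ ∈ → ∉ (Captured-resp (λ _ → refl) y≡ ∈)))
      (λ y → not-captured-𝓔 y (λ _ → id))
      (λ x B⊆ → Captured-null (point x) (λ y∈ → decidable-stable (em 0ℓ) (B⊆ _ y∈)))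
  where open DaviesRogersSpace em R D
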